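{- There is no $5$-by-$24$ shorthand universal torus for the permutations of $\{0,1,2,3,4\}$ with $2$-by-$2$ windows.
   Context: A $5$-by-$24$ shorthand universal torus for the permutations of $\{0,1,2,3,4\}$ with $2$-by-$2$ windows is an array $T : \mathbb{Z}_5 \times \mathbb{Z}_{24} \to \{0,1,2,3,4\}$ (row indices modulo $5$, column indices modulo $24$) such that every word of length $4$ with pairwise distinct entries in $\{0,1,2,3,4\}$ is equal to the row-major reading $T(i,j)\,T(i,j+1)\,T(i+1,j)\,T(i+1,j+1)$ for exactly one position $(i,j)\in \mathbb{Z}_5\times\mathbb{Z}_{24}$. (Each such word encodes a permutation of five symbols by appending its missing symbol.) -}

module Defs where

open import Data.Fin.Base using (Fin; toℕ)
open import Data.Nat.Base using (suc; NonZero)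
open import Data.Nat.DivMod using (_mod_)
open import Data.Product using (_×_; _,_; ∃!)
open import Data.Vec.Base using (Vec; []; _∷_)
open import Data.Vec.Relation.Unary.Unique.Propositional using (Unique)
open import Relation.Binary.PropositionalEquality using (_≡_)

-- i + 1 in ℤ/n, with Fin n as the set of residues.
next : ∀ {n} .{{_ : NonZero n}} → Fin n → Fin n
next {n} i = suc (toℕ i) mod n

Torus : Set
Torus = Fin 5 → Fin 24 → Fin 5

window : Torus → Fin 5 × Fin 24 → Vec (Fin 5) 4
window T (i , j) =
  T i        j ∷ T i        (next j) ∷
  T (next i) j ∷ T (next i) (next j) ∷ []

IsShorthandUniversal : Torus → Set
IsShorthandUniversal T =
  (w : Vec (Fin 5) 4) → Unique w → ∃! _≡_ (λ p → window T p ≡ w)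

{-# OPTIONS --safe #-}
module Submission where

-- There are as many positions as words, so every window consists of distinct
-- symbols.  For two adjacent columns this means that each row pair {C r , D r}
-- is disjoint from the next one; since three pairwise disjoint pairs do not fit
-- into five symbols, row pairs at distance two meet, and every symbol occupies
-- exactly two of the ten cells, in rows at distance two.
-- If some column repeats a symbol x, it misses some symbol y; then x and y
-- alternate between occurring twice and not at all, in opposite phase, along
-- all columns, so they never share a column.  Otherwise every column is a
-- permutation, and two symbols at distance two in one column stay at distance
-- two in all of them.  Either way some two symbols are never vertically
-- adjacent, although some word requires it.

open import Defs
open import Data.Fin.Base
  using (Fin; zero; suc; toℕ; inject₁; _<_; combine; remQuot; punchIn; punchOut)
open import Data.Fin.Induction using (<-weakInduction)
open import Data.Fin.Patterns using (0F; 1F; 2F; 3F; 4F)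
open import Data.Fin.Properties
  using (_≟_; all?; any?; <⇒≢; toℕ<n; toℕ-injective; toℕ-inject₁; toℕ-fromℕ<;
         pigeonhole; combine-injective; combine-remQuot;
         punchInᵢ≢i; punchIn-injective; punchOut-injective)
open import Data.Nat.Base as ℕ using (ℕ; zero; suc; _+_; _*_; s<s)
open import Data.Nat.DivMod using (m<n⇒m%n≡m)
open import Data.Nat.Properties using (≤-refl)
open import Data.Product using (∃; ∃₂; _×_; _,_; proj₁; proj₂; uncurry)
open import Data.Sum.Base as Sum using (_⊎_; inj₁; inj₂)
open import Data.Vec.Base using (Vec; []; _∷_; map; lookup)
open import Data.Vec.Properties using (∷-injective)
open import Data.Vec.Relation.Unary.All using ([]; _∷_; universal)
open import Data.Vec.Relation.Unary.All.Properties using (map⁺)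
open import Data.Vec.Relation.Unary.AllPairs using ([]; _∷_; allPairs?)
open import Data.Vec.Relation.Unary.Unique.Propositional using (Unique)
import Data.Vec.Relation.Unary.Unique.Propositional.Properties as Unique
open import Function.Base using (_∘_)
open import Function.Definitions using (Injective)
open import Relation.Binary.PropositionalEquality
  using (_≡_; _≢_; refl; sym; trans; cong; cong₂; subst; ≢-sym)
open import Relation.Nullary using (¬_; yes; no; contradiction)
open import Relation.Nullary.Decidable using (toWitness; ¬?; _⊎-dec_; _→-dec_)

-- Pigeonhole arguments and induction along a cycle.

-- Pigeonhole on `y` followed by all values of `f`: since `f` is injective, the collision involves
-- `y`.
injective⇒surjective : ∀ {n} {f : Fin n → Fin n} → Injective _≡_ _≡_ f →
                       ∀ y → ∃ λ x → f x ≡ y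
injective⇒surjective {n} {f} f-inj y = preimage (pigeonhole ≤-refl g)
  where
  g : Fin (suc n) → Fin n
  g zero    = y
  g (suc x) = f x

  preimage : (∃₂ λ i j → i < j × g i ≡ g j) → ∃ λ x → f x ≡ y
  preimage (zero  , suc x , _   , eq) = x , sym eq
  preimage (suc i , suc j , i<j , eq) = contradiction (cong suc (f-inj eq)) (<⇒≢ i<j)

injective⇒surjective-× : ∀ {m n} {f : Fin (m * n) → Fin m × Fin n} → Injective _≡_ _≡_ f →
                         ∀ p → ∃ λ k → f k ≡ p
injective⇒surjective-× f-inj (i , j) =
  let k , eq = injective⇒surjective (f-inj ∘ uncurry (cong₂ _,_) ∘ combine-injective _ _ _ _) (combine i j)
  in k , uncurry (cong₂ _,_) (combine-injective _ _ i j eq)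

-- Deleting the missed value leaves fewer values than arguments.
missing⇒collision : ∀ {n} {f : Fin n → Fin n} {y} → (∀ x → f x ≢ y) →
                    ∃₂ λ i j → i ≢ j × f i ≡ f j
missing⇒collision {suc n} {f} {y} f≢y =
  let i , j , i<j , eq = pigeonhole ≤-refl (λ x → punchOut (≢-sym (f≢y x)))
  in i , j , <⇒≢ i<j , punchOut-injective (≢-sym (f≢y i)) (≢-sym (f≢y j)) eq

remQuot-injective : ∀ {m} n → Injective _≡_ _≡_ (remQuot {m} n)
remQuot-injective {m} n {i} {j} eq =
  trans (sym (combine-remQuot {m} n i)) (trans (cong (uncurry combine) eq) (combine-remQuot {m} n j))

next-inject₁ : ∀ {n} (i : Fin n) → next (inject₁ i) ≡ suc i
next-inject₁ {n} i = toℕ-injective (trans (toℕ-fromℕ< _)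
  (trans (m<n⇒m%n≡m (subst (λ k → suc k ℕ.< suc n) (sym (toℕ-inject₁ i)) (s<s (toℕ<n i))))
         (cong suc (toℕ-inject₁ i))))

next-induction : ∀ {n} (P : Fin (suc n) → Set) → P zero → (∀ i → P i → P (next i)) → ∀ i → P i
next-induction P P₀ step =
  <-weakInduction P P₀ (λ i Pi → subst P (next-inject₁ i) (step (inject₁ i) Pi))

-- Words with distinct entries.

map-injective : ∀ {A B : Set} {f : A → B} → Injective _≡_ _≡_ f → ∀ {n} → Injective _≡_ _≡_ (map {n = n} f)
map-injective f-inj {_} {[]}     {[]}     _  = refl
map-injective f-inj {_} {x ∷ xs} {y ∷ ys} eq =
  let eq₁ , eq₂ = ∷-injective eq
  in cong₂ _∷_ (f-inj eq₁) (map-injective f-inj eq₂)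

-- The falling factorial (m + n) ⋯ (n + 1).
#arrangements : ℕ → ℕ → ℕ
#arrangements zero    n = 1
#arrangements (suc m) n = suc (m + n) * #arrangements m n

-- This is decoding of a Lehmer code, with the first entry as leading digit.
arrangement : ∀ m n → Fin (#arrangements m n) → Vec (Fin (m + n)) m
arrangement zero    n k = []
arrangement (suc m) n k =
  let a , l = remQuot {suc (m + n)} (#arrangements m n) k
  in a ∷ map (punchIn a) (arrangement m n l)

arrangement-unique : ∀ m n k → Unique (arrangement m n k)
arrangement-unique zero    n k = []
arrangement-unique (suc m) n k =
  let a , l = remQuot {suc (m + n)} (#arrangements m n) k
  in map⁺ (universal (λ b → ≢-sym (punchInᵢ≢i a b)) _)
     ∷ Unique.map⁺ (punchIn-injective a _ _) (arrangement-unique m n l)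

arrangement-injective : ∀ m n → Injective _≡_ _≡_ (arrangement m n)
arrangement-injective zero    n {0F} {0F} _ = refl
arrangement-injective (suc m) n {k} {k′} eq = remQuot-injective {suc (m + n)} (#arrangements m n) (go _ _ eq)
  where
  go : ∀ (p q : Fin (suc (m + n)) × Fin (#arrangements m n)) → let (a , l) = p ; (a′ , l′) = q in
       a ∷ map (punchIn a) (arrangement m n l) ≡ a′ ∷ map (punchIn a′) (arrangement m n l′) → p ≡ q
  go (a , l) (a′ , l′) eq with refl , eq′ ← ∷-injective eq =
    cong (a ,_) (arrangement-injective m n (map-injective (punchIn-injective a _ _) eq′))

-- The window at `position k` recovers the word, so `position` is injective. As 5 · 4 · 3 · 2 = 5 ·
-- 24, it is also onto.
window-unique : ∀ T → IsShorthandUniversal T → ∀ p → Unique (window T p)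
window-unique T universal p =
  let k , eq = injective⇒surjective-× {5} {24} position-injective p
  in subst Unique (trans (sym (window-position k)) (cong (window T) eq)) (arrangement-unique 4 1 k)
  where
  position : Fin (#arrangements 4 1) → Fin 5 × Fin 24
  position k = proj₁ (universal (arrangement 4 1 k) (arrangement-unique 4 1 k))

  window-position : ∀ k → window T (position k) ≡ arrangement 4 1 k
  window-position k = proj₁ (proj₂ (universal (arrangement 4 1 k) (arrangement-unique 4 1 k)))

  position-injective : Injective _≡_ _≡_ position
  position-injective {k} {l} eq = arrangement-injective 4 1
    (trans (sym (window-position k)) (trans (cong (window T) eq) (window-position l)))

-- Rows modulo 5.

-- Unlike next, this is stuck on a variable, which keeps normal forms small.
suc₅ : Fin 5 → Fin 5
suc₅ 0F = 1F
suc₅ 1F = 2F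
suc₅ 2F = 3F
suc₅ 3F = 4F
suc₅ 4F = 0F

suc₅≡next : ∀ r → suc₅ r ≡ next r
suc₅≡next = toWitness {a? = all? λ r → suc₅ r ≟ next r} _

suc₅² suc₅³ suc₅⁴ : Fin 5 → Fin 5
suc₅² r = suc₅ (suc₅ r)
suc₅³ r = suc₅ (suc₅² r)
suc₅⁴ r = suc₅ (suc₅³ r)

suc₅⁵ : ∀ r → suc₅ (suc₅⁴ r) ≡ r
suc₅⁵ = toWitness {a? = all? λ r → suc₅ (suc₅⁴ r) ≟ r} _

data Offset : Fin 5 → Fin 5 → Set where
  same  : ∀ {r} → Offset r r
  up₁   : ∀ {r} → Offset r (suc₅ r)
  up₂   : ∀ {r} → Offset r (suc₅² r)
  down₁ : ∀ {r} → Offset (suc₅ r) r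
  down₂ : ∀ {r} → Offset (suc₅² r) r

offset : ∀ r s → Offset r s
offset r s = view (cases r s)
  where
  Cases : Fin 5 → Fin 5 → Set
  Cases r s = r ≡ s ⊎ suc₅ r ≡ s ⊎ suc₅² r ≡ s ⊎ r ≡ suc₅ s ⊎ r ≡ suc₅² s

  cases : ∀ r s → Cases r s
  cases = toWitness {a? = all? λ r → all? λ s →
    r ≟ s ⊎-dec suc₅ r ≟ s ⊎-dec suc₅² r ≟ s ⊎-dec r ≟ suc₅ s ⊎-dec r ≟ suc₅² s} _

  view : ∀ {r s} → Cases r s → Offset r s
  view (inj₁ refl)                      = same
  view (inj₂ (inj₁ refl))               = up₁
  view (inj₂ (inj₂ (inj₁ refl)))        = up₂
  view (inj₂ (inj₂ (inj₂ (inj₁ refl)))) = down₁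
  view (inj₂ (inj₂ (inj₂ (inj₂ refl)))) = down₂

suc₅-≢ : ∀ r → suc₅ r ≢ r
suc₅-≢ = toWitness {a? = all? λ r → ¬? (suc₅ r ≟ r)} _

suc₅²-≢ : ∀ r → suc₅² r ≢ r
suc₅²-≢ = toWitness {a? = all? λ r → ¬? (suc₅² r ≟ r)} _

suc₅³-≢ : ∀ r → suc₅³ r ≢ r
suc₅³-≢ = toWitness {a? = all? λ r → ¬? (suc₅³ r ≟ r)} _

-- Patterns of symbols in a column.

Column : Set
Column = Fin 5 → Fin 5

Absent : Column → Fin 5 → Set
Absent C s = ∀ r → C r ≢ s

-- Within a strip, distance two is the only way to repeat (`collision⇒Twice`).
Twice : Column → Fin 5 → Set
Twice C s = ∃ λ r → C r ≡ s × C (suc₅² r) ≡ s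

-- Moving to the next column swaps the two alternatives, so the disjunction is an invariant.
Opposite : Column → Fin 5 → Fin 5 → Set
Opposite C x y = (Twice C x × Absent C y) ⊎ (Absent C x × Twice C y)

-- Both orders are allowed, since moving to the next column may exchange them.
Apart : Column → Fin 5 → Fin 5 → Set
Apart C x y = ∃ λ r → (C r ≡ x × C (suc₅² r) ≡ y) ⊎ (C r ≡ y × C (suc₅² r) ≡ x)

Apart-sym : ∀ {C x y} → Apart C x y → Apart C y x
Apart-sym (r , p) = r , Sum.swap p

-- Strips of two adjacent columns.

other : ∀ {c d e : Fin 2} → d ≢ c → e ≢ c → d ≡ e
other {0F} {0F} {_}  d≢c e≢c = contradiction refl d≢c
other {0F} {1F} {0F} d≢c e≢c = contradiction refl e≢c
other {0F} {1F} {1F} d≢c e≢c = refl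
other {1F} {1F} {_}  d≢c e≢c = contradiction refl d≢c
other {1F} {0F} {1F} d≢c e≢c = contradiction refl e≢c
other {1F} {0F} {0F} d≢c e≢c = refl

-- Two adjacent columns K 0F and K 1F whose windows have distinct symbols.
record IsStrip (K : Fin 2 → Column) : Set where
  field
    row-injective : ∀ {r c d} → K c r ≡ K d r → c ≡ d
    row-disjoint  : ∀ r {c d} → K c r ≢ K d (suc₅ r)

module Strip {K : Fin 2 → Column} (isStrip : IsStrip K) where
  open IsStrip isStrip

  -- Rows r, r + 1, r + 2 have six cells for five symbols, and a repeat within a row or between
  -- adjacent rows is excluded.
  meet : ∀ r → ∃₂ λ c d → K c r ≡ K d (suc₅² r)
  meet r =
    let i , j , i<j , eq = pigeonhole {5} {6} ≤-refl (uncurry cell ∘ remQuot 2)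
    in collide _ _ _ _ (<⇒≢ i<j ∘ remQuot-injective {3} 2) eq
    where
    rows : Fin 3 → Fin 5
    rows = lookup (r ∷ suc₅ r ∷ suc₅² r ∷ [])

    cell : Fin 3 → Fin 2 → Fin 5
    cell ρ c = K c (rows ρ)

    collide : ∀ ρ c σ d → (ρ , c) ≢ (σ , d) → cell ρ c ≡ cell σ d → ∃₂ λ c d → K c r ≡ K d (suc₅² r)
    collide 0F c 2F d _ eq = c , d , eq
    collide 2F c 0F d _ eq = d , c , sym eq
    collide 0F c 0F d ne eq = contradiction (cong (0F ,_) (row-injective eq)) ne
    collide 1F c 1F d ne eq = contradiction (cong (1F ,_) (row-injective eq)) ne
    collide 2F c 2F d ne eq = contradiction (cong (2F ,_) (row-injective eq)) ne
    collide 0F c 1F d _ eq = contradiction eq (row-disjoint r)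
    collide 1F c 0F d _ eq = contradiction (sym eq) (row-disjoint r)
    collide 1F c 2F d _ eq = contradiction eq (row-disjoint (suc₅ r))
    collide 2F c 1F d _ eq = contradiction (sym eq) (row-disjoint (suc₅ r))

  -- The symbols that row r shares with rows r + 2 and r + 3 differ, because
  -- these two rows are adjacent; so they are the two symbols of row r.
  partner : ∀ c r → (∃ λ d → K d (suc₅² r) ≡ K c r) ⊎ (∃ λ d → K d (suc₅³ r) ≡ K c r)
  -- Row r + 5 is row r, so the second `meet` compares row r + 3 with row r.
  partner c r with meet r | meet (suc₅³ r)
  ... | c₁ , d₁ , eq₁ | d₂ , c₂ , eq₂ rewrite suc₅⁵ r with c ≟ c₁
  ...   | yes refl = inj₁ (d₁ , sym eq₁)
  ...   | no c≢c₁ with other {c₁} c≢c₁ c₂≢c₁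
    where
    c₂≢c₁ : c₂ ≢ c₁
    c₂≢c₁ refl = row-disjoint (suc₅² r) (trans (sym eq₁) (sym eq₂))
  ...     | refl = inj₂ (d₂ , eq₂)

  -- Rows 0 and 1 hold four distinct symbols. The symbol shared by rows 2 and 4 is a fifth: row 2 is
  -- adjacent to row 1, and row 4 to row 0.
  occurs : ∀ s → ∃₂ λ c r → K c r ≡ s
  occurs s with meet 2F
  ... | e , f , eq = locate (injective⇒surjective (λ {i} {j} → Unique.lookup-injective five-unique i j) s)
    where
    five : Vec (Fin 5) 5
    five = K 0F 0F ∷ K 1F 0F ∷ K 0F 1F ∷ K 1F 1F ∷ K e 2F ∷ []

    new : ∀ c → K c 0F ≢ K e 2F
    new c eq′ = row-disjoint 4F (trans (sym eq) (sym eq′))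

    five-unique : Unique five
    five-unique =
      ((λ eq → contradiction (row-injective eq) λ ()) ∷ row-disjoint 0F ∷ row-disjoint 0F ∷ new 0F ∷ []) ∷
      (row-disjoint 0F ∷ row-disjoint 0F ∷ new 1F ∷ []) ∷
      ((λ eq → contradiction (row-injective eq) λ ()) ∷ row-disjoint 1F ∷ []) ∷
      (row-disjoint 1F ∷ []) ∷ [] ∷ []

    locate : (∃ λ i → lookup five i ≡ s) → ∃₂ λ c r → K c r ≡ s
    locate (0F , eq) = _ , _ , eq
    locate (1F , eq) = _ , _ , eq
    locate (2F , eq) = _ , _ , eq
    locate (3F , eq) = _ , _ , eq
    locate (4F , eq) = _ , _ , eq

  -- Every row is r, r + 2 or adjacent to one of them.
  Twice⇒Absent : ∀ {c d s} → d ≢ c → Twice (K c) s → Absent (K d) s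
  Twice⇒Absent d≢c (r , eq , eq₂) r′ eq′ with offset r r′
  ... | same         = d≢c (row-injective (trans eq′ (sym eq)))
  ... | up₁          = row-disjoint r (trans eq (sym eq′))
  ... | up₂          = d≢c (row-injective (trans eq′ (sym eq₂)))
  ... | down₁        = row-disjoint r′ (trans eq′ (sym eq))
  -- Modulo 5, row r - 2 is the row after r + 2.
  ... | down₂ {r₋₂}  = row-disjoint (suc₅⁴ r₋₂) (trans eq₂ (trans (sym eq′) (cong (K _) (sym (suc₅⁵ r₋₂)))))

  only-in : ∀ {c d r s} → d ≢ c → K c r ≢ s → (∃ λ e → K e r ≡ s) → K d r ≡ s
  only-in {c} {r = r} {s} d≢c not-c (e , eq) =
    subst (λ d → K d r ≡ s) (other (λ e≡c → not-c (subst (λ c → K c r ≡ s) e≡c eq)) d≢c) eq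

  -- The symbol occurs in the strip, hence in column `d`; its `partner` cannot lie in column `c`
  -- either.
  Absent⇒Twice : ∀ {c d s} → d ≢ c → Absent (K c) s → Twice (K d) s
  Absent⇒Twice {c} {d} {s} d≢c absent =
    let e , r , eq = occurs s in twice r (here (e , eq)) (partner d r)
    where
    here : ∀ {r} → (∃ λ e → K e r ≡ s) → K d r ≡ s
    here = only-in d≢c (absent _)

    twice : ∀ r → K d r ≡ s →
            (∃ λ e → K e (suc₅² r) ≡ K d r) ⊎ (∃ λ e → K e (suc₅³ r) ≡ K d r) → Twice (K d) s
    twice r eq (inj₁ (e , eq₂)) = r , eq , here (e , trans eq₂ eq)
    twice r eq (inj₂ (e , eq₃)) = suc₅³ r , here (e , trans eq₃ eq) , trans (cong (K d) (suc₅⁵ r)) eq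

  collision⇒Twice : ∀ {c r r′} → r ≢ r′ → K c r ≡ K c r′ → Twice (K c) (K c r)
  collision⇒Twice {c} {r} {r′} r≢r′ eq with offset r r′
  ... | same  = contradiction refl r≢r′
  ... | up₁   = contradiction eq (row-disjoint r)
  ... | up₂   = r , refl , sym eq
  ... | down₁ = contradiction (sym eq) (row-disjoint r′)
  ... | down₂ = r′ , sym eq , refl

  Absent⇒∃Twice : ∀ {c s} → Absent (K c) s → ∃ (Twice (K c))
  Absent⇒∃Twice absent =
    let r , r′ , r≢r′ , eq = missing⇒collision absent
    in _ , collision⇒Twice r≢r′ eq

  -- Column `d` misses `s`, so it repeats some `t`, which column `c` must then miss.
  Twice⇒Opposite : ∀ {c d s} → d ≢ c → Twice (K c) s → ∃ (Opposite (K c) s)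
  Twice⇒Opposite d≢c twice =
    let t , twice′ = Absent⇒∃Twice (Twice⇒Absent d≢c twice)
    in t , inj₁ (twice , Twice⇒Absent (≢-sym d≢c) twice′)

  Opposite-step : ∀ {c d x y} → d ≢ c → Opposite (K c) x y → Opposite (K d) x y
  Opposite-step d≢c (inj₁ (twice , absent)) = inj₂ (Twice⇒Absent d≢c twice , Absent⇒Twice d≢c absent)
  Opposite-step d≢c (inj₂ (absent , twice)) = inj₁ (Absent⇒Twice d≢c absent , Twice⇒Absent d≢c twice)

  rainbow : ∀ {c} → (∀ s → ¬ Twice (K c) s) → Injective _≡_ _≡_ (K c)
  rainbow ¬twice {r} {r′} eq with r ≟ r′
  ... | yes r≡r′ = r≡r′
  ... | no  r≢r′ = contradiction (collision⇒Twice r≢r′ eq) (¬twice _)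

  -- A symbol repeated in `d` would be absent from `c`, which contains all five.
  rainbow-step : ∀ {c d} → d ≢ c → Injective _≡_ _≡_ (K c) → Injective _≡_ _≡_ (K d)
  rainbow-step d≢c inj = rainbow λ s twice →
    let r , eq = injective⇒surjective inj s
    in Twice⇒Absent (≢-sym d≢c) twice r eq

  -- Without repeats in column `c`, the `partner` of a cell lies in the other column.
  move : ∀ {c d} → d ≢ c → Injective _≡_ _≡_ (K c) → ∀ r →
         K d (suc₅² r) ≡ K c r ⊎ K d (suc₅³ r) ≡ K c r
  move {c} {d} d≢c inj r =
    Sum.map (only-in d≢c (suc₅²-≢ r ∘ inj)) (only-in d≢c (suc₅³-≢ r ∘ inj)) (partner c r)

  -- The symbols in rows r and r + 2 could only become adjacent in rows r + 3
  -- and r + 4, but one of these is needed for the symbol in row r + 1.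
  move-apart : ∀ {c d} → d ≢ c → Injective _≡_ _≡_ (K c) → ∀ r → Apart (K d) (K c r) (K c (suc₅² r))
  move-apart {c} {d} d≢c inj r = go (move d≢c inj r) (move d≢c inj (suc₅ r)) (move d≢c inj (suc₅² r))
    where
    Moved : Fin 5 → Set
    Moved r = K d (suc₅² r) ≡ K c r ⊎ K d (suc₅³ r) ≡ K c r

    go : Moved r → Moved (suc₅ r) → Moved (suc₅² r) → Apart (K d) (K c r) (K c (suc₅² r))
    go (inj₁ x) _        (inj₁ y) = suc₅² r , inj₁ (x , y)
    go (inj₁ x) _        (inj₂ y) = r , inj₂ (trans (cong (K d) (sym (suc₅⁵ r))) y , x)
    go (inj₂ x) _        (inj₂ y) = suc₅³ r , inj₁ (x , y)
    go (inj₂ x) (inj₁ z) (inj₁ y) = contradiction (inj (trans (sym z) x)) (suc₅-≢ r)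
    go (inj₂ x) (inj₂ z) (inj₁ y) = contradiction (trans (sym z) y) (row-disjoint (suc₅ r))

  Apart-step : ∀ {c d x y} → d ≢ c → Injective _≡_ _≡_ (K c) → Apart (K c) x y → Apart (K d) x y
  Apart-step d≢c inj (r , inj₁ (refl , refl)) = move-apart d≢c inj r
  Apart-step d≢c inj (r , inj₂ (refl , refl)) = Apart-sym (move-apart d≢c inj r)

-- Injectivity fixes the rows of `x` and `y`; their difference is 2 or -2 modulo 5, never 1.
Apart⇒¬adjacent : ∀ {C x y r} → Injective _≡_ _≡_ C → Apart C x y → ¬ (C r ≡ x × C (suc₅ r) ≡ y)
Apart⇒¬adjacent inj (r , inj₁ (refl , refl)) (eq₁ , eq₂) with refl ← inj eq₁ = suc₅-≢ (suc₅ r) (sym (inj eq₂))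
Apart⇒¬adjacent {r = r} inj (s , inj₂ (refl , refl)) (eq₁ , eq₂) with refl ← inj eq₁ =
  contradiction (inj eq₂) (suc₅³-≢ s)

-- From strips to the whole torus.

-- The first and third letters form the left column of a window, so this word puts `x` directly
-- above `y`.
word-with : ∀ (x y : Fin 5) → x ≢ y → ∃₂ λ u v → Unique (x ∷ u ∷ y ∷ v ∷ [])
word-with = toWitness
  {a? = all? λ x → all? λ y → ¬? (x ≟ y) →-dec
        any? λ u → any? λ v → allPairs? (λ a b → ¬? (a ≟ b)) (x ∷ u ∷ y ∷ v ∷ [])} _

-- Column `1F` of a strip is definitionally column `0F` of the next strip, so invariants pass along.
strip : Torus → Fin 24 → Fin 2 → Column
strip T j c i = T i (lookup (j ∷ next j ∷ []) c)

strip-isStrip : ∀ T → (∀ p → Unique (window T p)) → ∀ j → IsStrip (strip T j)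
strip-isStrip T unique j = record { row-injective = row-injective ; row-disjoint = row-disjoint }
  where
  row-injective : ∀ {r c d} → strip T j c r ≡ strip T j d r → c ≡ d
  row-injective {c = 0F} {0F} _ = refl
  row-injective {c = 1F} {1F} _ = refl
  row-injective {r} {0F} {1F} eq with (a≢b ∷ _) ∷ _ ← unique (r , j) = contradiction eq a≢b
  row-injective {r} {1F} {0F} eq with (a≢b ∷ _) ∷ _ ← unique (r , j) = contradiction (sym eq) a≢b

  row-disjoint : ∀ r {c d} → strip T j c r ≢ strip T j d (suc₅ r)
  row-disjoint r {c} {d} rewrite suc₅≡next r with c | d | unique (r , j)
  ... | 0F | 0F | (_ ∷ a≢c ∷ _ ∷ []) ∷ _ = a≢c
  ... | 0F | 1F | (_ ∷ _ ∷ a≢d ∷ []) ∷ _ = a≢d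
  ... | 1F | 0F | _ ∷ (b≢c ∷ _ ∷ []) ∷ _ = b≢c
  ... | 1F | 1F | _ ∷ (_ ∷ b≢d ∷ []) ∷ _ = b≢d

vertical : ∀ T → IsShorthandUniversal T → ∀ {x y} → x ≢ y → ∃₂ λ i j → T i j ≡ x × T (suc₅ i) j ≡ y
vertical T universal x≢y =
  let u , v , w! = word-with _ _ x≢y
      (i , j) , eq , _ = universal _ w!
      eq₁ , eqs = ∷-injective eq
      eq₃ , _ = ∷-injective (proj₂ (∷-injective eqs))
  in i , j , eq₁ , trans (cong (λ i → T i j) (suc₅≡next i)) eq₃

Opposite⇒≢ : ∀ {C x y} → Opposite C x y → x ≢ y
Opposite⇒≢ (inj₁ ((r , eq , _) , absent)) x≡y = absent r (trans eq x≡y)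
Opposite⇒≢ (inj₂ (absent , (r , eq , _))) x≡y = absent r (trans eq (sym x≡y))

Opposite⇒¬adjacent : ∀ {C x y r} → Opposite C x y → ¬ (C r ≡ x × C (suc₅ r) ≡ y)
Opposite⇒¬adjacent (inj₁ (_ , absent)) (_ , eq) = absent _ eq
Opposite⇒¬adjacent (inj₂ (absent , _)) (eq , _) = absent _ eq

module _ (T : Torus) (isStrip : ∀ j → IsStrip (strip T j)) where
  module At (j : Fin 24) = Strip (isStrip j)

  column : Fin 24 → Column
  column j = strip T j 0F

  Opposite-everywhere : ∀ {x y} → Opposite (column 0F) x y → ∀ j → Opposite (column j) x y
  Opposite-everywhere {x} {y} opposite =
    next-induction (λ j → Opposite (column j) x y) opposite (λ j → At.Opposite-step j {0F} {1F} λ ())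

  Apart-everywhere : ∀ {x y} → Injective _≡_ _≡_ (column 0F) → Apart (column 0F) x y →
                     ∀ j → Injective _≡_ _≡_ (column j) × Apart (column j) x y
  Apart-everywhere {x} {y} inj apart =
    next-induction (λ j → Injective _≡_ _≡_ (column j) × Apart (column j) x y) (inj , apart)
      (λ j (inj , apart) → At.rainbow-step j {0F} {1F} (λ ()) inj , At.Apart-step j {0F} {1F} (λ ()) inj apart)

  never-adjacent : ∃₂ λ x y → x ≢ y × ∀ i j → ¬ (T i j ≡ x × T (suc₅ i) j ≡ y)
  -- Testing distance two suffices to detect any repeat in column 0.
  never-adjacent with any? (λ r → T (suc₅² r) 0F ≟ T r 0F)
  ... | yes (r , eq) =
    let y , opposite = At.Twice⇒Opposite 0F {0F} {1F} (λ ()) (r , refl , eq)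
    in T r 0F , y , Opposite⇒≢ opposite , λ i j → Opposite⇒¬adjacent (Opposite-everywhere opposite j)
  ... | no ¬repeat =
    T 0F 0F , T 2F 0F , (λ eq → contradiction (inj eq) λ ()) , λ i j →
      let injⱼ , apart = Apart-everywhere inj (0F , inj₁ (refl , refl)) j
      in Apart⇒¬adjacent injⱼ apart
    where
    inj : Injective _≡_ _≡_ (column 0F)
    inj = At.rainbow 0F {0F} λ s (r , eq , eq₂) → ¬repeat (r , trans eq₂ (sym eq))

theorem3 : ¬ (∃ λ (T : Torus) → IsShorthandUniversal T)
theorem3 (T , universal) =
  let x , y , x≢y , never = never-adjacent T (strip-isStrip T (window-unique T universal))
      i , j , adjacent = vertical T universal x≢y
  in never i j adjacent
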